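{- Let $G$ be a graph of order $n$ with no isolated vertices. Then $\gamma_{\rm gr}^t(G)=n$ if and only if there is an integer $k$ with $n=2k$ such that the vertices of $G$ can be labeled $x_1,\ldots,x_k,y_1,\ldots,y_k$ so that: (i) $x_i$ is adjacent to $y_i$ for each $i\in\{1,\ldots,k\}$; (ii) $\{x_1,\ldots,x_k\}$ is an independent set; and (iii) whenever $y_j$ is adjacent to $x_i$, we have $i \ge j$.
   Context: All graphs are finite, simple, without isolated vertices. $N(v)$ denotes the open neighborhood of $v$. A sequence $S=(v_1,\ldots,v_k)$ of distinct vertices of $G$ is a legal (open neighborhood) sequence if $N(v_i)\setminus \bigcup_{j=1}^{i-1} N(v_j)\neq\emptyset$ for every $i\in\{2,\ldots,k\}$. It is a total dominating sequence if moreover the set $\{v_1,\ldots,v_k\}$ is a total dominating set of $G$ (every vertex has a neighbor in it). The Grundy total domination number $\gamma_{\rm gr}^t(G)$ is the maximum length of a total dominating sequence of $G$. -}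

module Defs where

open import Data.Fin.Base using (Fin; toℕ; _<_; _≥_)
open import Data.Nat.Base using (ℕ; _≤_)
open import Data.Product.Base using (Σ-syntax; ∃-syntax; _×_; _,_)
open import Data.Sum.Base using ([_,_]′)
open import Function.Definitions using (Injective; Bijective)
open import Level using (0ℓ)
open import Relation.Binary.Core using (Rel)
open import Relation.Binary.Definitions using (Decidable; Irreflexive; Symmetric)
open import Relation.Binary.PropositionalEquality.Core using (_≡_)
open import Relation.Nullary.Negation.Core using (¬_)
open import Relation.Unary using (Pred; _∈_; _∖_; ⋃; Satisfiable)

-- Decidability of adjacency is part of what it means for the graph to be
-- finite.
record Graph (n : ℕ) : Set₁ where
  field
    Adj    : Rel (Fin n) 0ℓ
    adj?   : Decidable Adj
    sym    : Symmetric Adj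
    irrefl : Irreflexive _≡_ Adj

  N : Fin n → Pred (Fin n) 0ℓ
  N v = Adj v

  NoIsolatedVertices : Set
  NoIsolatedVertices = ∀ v → ∃⟨ N v ⟩

  IsIndependent : Pred (Fin n) 0ℓ → Set
  IsIndependent A = ∀ {u v} → u ∈ A → v ∈ A → ¬ Adj u v

  IsTotalDominatingSet : Pred (Fin n) 0ℓ → Set
  IsTotalDominatingSet D = ∀ v → ∃[ u ] (u ∈ D × Adj v u)

range : ∀ {k n} → (Fin k → Fin n) → Pred (Fin n) 0ℓ
range f v = ∃[ i ] f i ≡ v

module _ {n : ℕ} (G : Graph n) where
  open Graph G

  -- Indices start at 0, so 1 ≤ toℕ i excludes exactly the first vertex,
  -- on which no condition is imposed.
  record IsLegalSequence {k : ℕ} (S : Fin k → Fin n) : Set where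
    field
      distinct : Injective _≡_ _≡_ S
      legal    : ∀ i → 1 ≤ toℕ i →
                 ∃⟨ N (S i) ∖ ⋃ (Σ[ j ∈ Fin k ] j < i) (λ (j , _) → N (S j)) ⟩

  record IsTotalDominatingSequence {k : ℕ} (S : Fin k → Fin n) : Set where
    field
      isLegalSequence      : IsLegalSequence S
      isTotalDominatingSet : IsTotalDominatingSet (range S)

  -- The number γᵗgr(G) equals m when m is the maximum length of a total dominating sequence:
  -- it is attained, and it is an upper bound.
  record IsGrundyTotalDominationNumber (m : ℕ) : Set where
    field
      attained   : ∃[ S ] IsTotalDominatingSequence {m} S
      upperBound : ∀ {k} (S : Fin k → Fin n) → IsTotalDominatingSequence S → k ≤ m

  record IsLabelling {k : ℕ} (x y : Fin k → Fin n) : Set where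
    field
      bijective   : Bijective _≡_ _≡_ [ x , y ]′
      matched     : ∀ i → Adj (x i) (y i)
      independent : IsIndependent (range x)
      ordered     : ∀ i j → Adj (y j) (x i) → i ≥ j

{-# OPTIONS --safe #-}

-- Suppose the legal sequence S lists all n vertices. For each i choose σ i such
-- that the vertex at position σ i is newly footprinted by the i-th vertex. Then
-- i is the first neighbour of σ i. Since σ i is a neighbour of σ (σ i), this
-- gives i ≤ σ (σ i) for all i, and an injective inflationary map of a finite
-- chain is the identity, so σ is a fixed-point-free involution. The yᵢ are the
-- later members of the pairs {i , σ i}, listed in decreasing order of position.
-- Conversely, x₁ … xₖ yₖ … y₁ is legal: xᵢ footprints yᵢ and yᵢ footprints xᵢ.

module Submission where

open import Defs
open import Data.Fin.Base using (Fin; zero; suc; toℕ; _<_; _≤_; join; opposite; punchOut; splitAt)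
open import Data.Fin.Induction using (>-wellFounded; Acc; acc)
open import Data.Fin.Permutation using (↔⇒≡)
open import Data.Fin.Properties
  using ( _≟_; _<?_; any?; +↔⊎; injective⇒≤; punchOut-injective; opposite-prop
        ; opposite-involutive; toℕ<n; toℕ-↑ˡ; toℕ-↑ʳ; splitAt-join; join-splitAt
        ; ≤-antisym; <-cmp)
open import Data.Nat.Base as ℕ using (ℕ; zero; suc; _+_; _*_; z≤n; s≤s; s≤s⁻¹)
import Data.Nat.Properties as ℕ
open import Data.Product.Base using (Σ-syntax; ∃-syntax; _×_; _,_; proj₁; proj₂)
open import Data.Sum.Base using (_⊎_; inj₁; inj₂; [_,_]′; map₂)
open import Function.Base using (_∘_)
open import Function.Bundles using (_⇔_; mk⇔; mk⤖)
open import Function.Consequences.Propositional using (strictlySurjective⇒surjective)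
open import Function.Construct.Composition using (_↔-∘_)
open import Function.Definitions using (Injective; StrictlySurjective)
open import Function.Properties.Bijection using (⤖⇒↔)
open import Level using (0ℓ)
open import Relation.Binary.Definitions using (tri<; tri≈; tri>)
open import Relation.Binary.PropositionalEquality
  using (_≡_; refl; sym; trans; cong; subst; subst₂; module ≡-Reasoning)
open import Relation.Nullary using (¬_; yes; no; contradiction)
open import Relation.Unary using (Pred; Decidable; _∖_; ⋃; Satisfiable)

-- Injective self-maps of a finite chain.

injective⇒strictlySurjective : ∀ {n} {f : Fin n → Fin n} →
  Injective _≡_ _≡_ f → StrictlySurjective _≡_ f
injective⇒strictlySurjective {suc n} {f} f-inj y with any? (λ x → f x ≟ y)
... | yes hit  = hit
-- Punching the missed value out of the codomain leaves an injection of `Fin (suc n)` into `Fin n`.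
... | no  miss = contradiction (injective⇒≤ punched-inj) ℕ.1+n≰n
  where
  y≢f : ∀ x → ¬ y ≡ f x
  y≢f x y≡fx = miss (x , sym y≡fx)

  punched-inj : Injective _≡_ _≡_ (λ x → punchOut (y≢f x))
  punched-inj eq = f-inj (punchOut-injective (y≢f _) (y≢f _) eq)

-- Induction from the top down: if `i < g i`, then `g` already fixes `g i`, and injectivity turns
-- `g (g i) ≡ g i` into `g i ≡ i`.
injective∧inflationary⇒id : ∀ {n} {g : Fin n → Fin n} →
  Injective _≡_ _≡_ g → (∀ i → i ≤ g i) → ∀ i → g i ≡ i
injective∧inflationary⇒id {g = g} g-inj i≤gi i = go i (>-wellFounded i)
  where
  go : ∀ i → Acc (λ a b → b < a) i → g i ≡ i
  go i (acc rec) with <-cmp i (g i)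
  ... | tri< i<gi _ _ = g-inj (go (g i) (rec i<gi))
  ... | tri≈ _ i≡gi _ = sym i≡gi
  ... | tri> _ _ gi<i = contradiction (i≤gi i) (ℕ.<⇒≱ gi<i)

-- Order reversal and increasing enumeration of a decidable subset.

opposite-anti-≤ : ∀ {n} {i j : Fin n} → i ≤ j → opposite j ≤ opposite i
opposite-anti-≤ {n} {i} {j} i≤j =
  subst₂ ℕ._≤_ (sym (opposite-prop j)) (sym (opposite-prop i)) (ℕ.∸-monoʳ-≤ n (s≤s i≤j))

opposite-cancel-≤ : ∀ {n} {i j : Fin n} → opposite i ≤ opposite j → j ≤ i
opposite-cancel-≤ {i = i} {j} le =
  subst₂ _≤_ (opposite-involutive j) (opposite-involutive i) (opposite-anti-≤ le)

-- Order is recorded as reflection, since the condition `ordered` requires passing from comparisons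
-- of vertices to comparisons of indices; injectivity then follows by antisymmetry.
record Enumeration {n} (P : Pred (Fin n) 0ℓ) : Set where
  field
    size     : ℕ
    at       : Fin size → Fin n
    cancel-≤ : ∀ {i j} → at i ≤ at j → i ≤ j
    sound    : ∀ i → P (at i)
    complete : ∀ {v} → P v → ∃[ i ] at i ≡ v

  at-injective : Injective _≡_ _≡_ at
  at-injective eq = ≤-antisym (cancel-≤ (ℕ.≤-reflexive (cong toℕ eq)))
                              (cancel-≤ (ℕ.≤-reflexive (cong toℕ (sym eq))))

enumerate : ∀ {n} {P : Pred (Fin n) 0ℓ} → Decidable P → Enumeration P
enumerate {zero} P? = record
  { size = 0 ; at = λ () ; cancel-≤ = λ { {()} } ; sound = λ () ; complete = λ { {()} } }
enumerate {suc n} {P} P? with enumerate (P? ∘ suc) | P? zero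
... | E | no ¬P0 = record
  { size     = size
  ; at       = suc ∘ at
  ; cancel-≤ = cancel-≤ ∘ s≤s⁻¹
  ; sound    = sound
  ; complete = λ { {zero}  P0 → contradiction P0 ¬P0
                 ; {suc v} Pv → let i , eq = complete Pv in i , cong suc eq }
  }
  where open Enumeration E
... | E | yes P0 = record
  { size     = suc size
  ; at       = λ { zero → zero ; (suc i) → suc (at i) }
  ; cancel-≤ = λ { {zero}  {_}     _  → z≤n
                 ; {suc i} {suc j} le → s≤s (cancel-≤ (s≤s⁻¹ le)) }
  ; sound    = λ { zero → P0 ; (suc i) → sound i }
  ; complete = λ { {zero}  _  → zero , refl
                 ; {suc v} Pv → let i , eq = complete Pv in suc i , cong suc eq }
  }
  where open Enumeration E

-- From a first-neighbour matching to a labelling.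

HasLabelling : ∀ {n} → Graph n → ℕ → Set
HasLabelling G k = ∃[ x ] ∃[ y ] IsLabelling G {k} x y

module FirstNeighbourMatching
  {n} (G : Graph n) (σ : Fin n → Fin n)
  (σ-adj   : ∀ i → Graph.Adj G i (σ i))
  (σ-first : ∀ {i j} → Graph.Adj G j (σ i) → i ≤ j)
  where

  open Graph G renaming (sym to Adj-sym)

  -- The index `i` can be recovered from `σ i` as its least neighbour.
  σ-injective : Injective _≡_ _≡_ σ
  σ-injective {i} {j} eq = ≤-antisym
    (σ-first (subst (Adj j) (sym eq) (σ-adj j)))
    (σ-first (subst (Adj i) eq (σ-adj i)))

  σ-involutive : ∀ i → σ (σ i) ≡ i
  σ-involutive = injective∧inflationary⇒id (σ-injective ∘ σ-injective)
    (λ i → σ-first (Adj-sym (σ-adj (σ i))))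

  -- The vertex `i` is itself a value of `σ`, namely at `σ i`, so its first neighbour is `σ i`.
  σ-least : ∀ {i j} → Adj i j → σ i ≤ j
  σ-least {i} {j} i~j =
    σ-first (subst (Adj j) (sym (σ-involutive i)) (Adj-sym i~j))

  open Enumeration (enumerate (λ i → σ i <? i))

  x y : Fin size → Fin n
  y = at ∘ opposite
  x = σ ∘ y

  σx≡y : ∀ i → σ (x i) ≡ y i
  σx≡y i = σ-involutive (y i)

  x<σx : ∀ i → x i < σ (x i)
  x<σx i = subst (x i <_) (sym (σx≡y i)) (sound (opposite i))

  y-injective : Injective _≡_ _≡_ y
  y-injective {i} {j} eq = begin
    i                       ≡⟨ opposite-involutive i ⟨
    opposite (opposite i)   ≡⟨ cong opposite (at-injective eq) ⟩
    opposite (opposite j)   ≡⟨ opposite-involutive j ⟩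
    j                       ∎
    where open ≡-Reasoning

  -- Each `x i` precedes its partner under `σ`, whereas each `y j` follows its own.
  x≢y : ∀ i j → ¬ x i ≡ y j
  x≢y i j eq = ℕ.<-asym (x<σx i)
    (subst (λ v → σ v < v) (sym eq) (sound (opposite j)))

  y-complete : ∀ {v} → σ v < v → ∃[ i ] y i ≡ v
  y-complete lt = let i , eq = complete lt in
    opposite i , trans (cong at (opposite-involutive i)) eq

  xy-injective : Injective _≡_ _≡_ [ x , y ]′
  xy-injective {inj₁ i} {inj₁ j} eq = cong inj₁ (y-injective (σ-injective eq))
  xy-injective {inj₁ i} {inj₂ j} eq = contradiction eq (x≢y i j)
  xy-injective {inj₂ i} {inj₁ j} eq = contradiction (sym eq) (x≢y j i)
  xy-injective {inj₂ i} {inj₂ j} eq = cong inj₂ (y-injective eq)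

  xy-surjective : StrictlySurjective _≡_ [ x , y ]′
  xy-surjective v with <-cmp v (σ v)
  ... | tri> _ _ σv<v = let i , eq = y-complete σv<v in inj₂ i , eq
  ... | tri≈ _ v≡σv _ = contradiction (σ-adj v) (irrefl v≡σv)
  -- Here the partner `σ v` is the later member of its pair, hence some `y i`, and `v` is the
  -- corresponding `x i`.
  ... | tri< v<σv _ _ =
    let i , eq = y-complete (subst (_< σ v) (sym (σ-involutive v)) v<σv)
    in inj₁ i , trans (cong σ eq) (σ-involutive v)

  -- Even the first neighbour of `x i`, its partner, comes after it. Two adjacent `x`-vertices would
  -- therefore each precede the other, whence independence.
  x-increases : ∀ i {v} → Adj (x i) v → x i < v
  x-increases i x~v = ℕ.<-≤-trans (x<σx i) (σ-least x~v)

  isLabelling : IsLabelling G x y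
  isLabelling = record
    { bijective   = xy-injective , strictlySurjective⇒surjective xy-surjective
    ; matched     = λ i → Adj-sym (σ-adj (y i))
    ; independent = λ { (i , refl) (j , refl) i~j →
        ℕ.<-asym (x-increases i i~j) (x-increases j (Adj-sym i~j)) }
    -- As `y i` is the first neighbour of `x i`, it satisfies `y i ≤ y j`; since `y` runs downwards,
    -- this means `j ≤ i`.
    ; ordered     = λ i j yj~xi → opposite-cancel-≤ (cancel-≤
        (subst (_≤ y j) (σx≡y i) (σ-least (Adj-sym yj~xi))))
    }

  hasLabelling : ∃[ k ] HasLabelling G k
  hasLabelling = size , x , y , isLabelling

-- From a legal sequence of all vertices to a labelling.

pullback : ∀ {m n} → (Fin m → Fin n) → Graph n → Graph m
pullback S G = record
  { Adj    = λ i j → Adj (S i) (S j)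
  ; adj?   = λ i j → adj? (S i) (S j)
  ; sym    = Adj-sym
  ; irrefl = irrefl ∘ cong S
  }
  where open Graph G renaming (sym to Adj-sym)

pullback-hasLabelling : ∀ {m n k} (G : Graph n) {S : Fin m → Fin n} →
  Injective _≡_ _≡_ S → StrictlySurjective _≡_ S →
  HasLabelling (pullback S G) k → HasLabelling G k
pullback-hasLabelling {k = k} G {S} S-inj S-surj (x , y , L) = S ∘ x , S ∘ y , record
  { bijective   = (λ {u} {v} eq → proj₁ bijective (S-inj
                    (trans (sym (∘-[,] u)) (trans eq (∘-[,] v)))))
                , strictlySurjective⇒surjective surj
  ; matched     = matched
  ; independent = λ { (i , refl) (j , refl) → independent (i , refl) (j , refl) }
  ; ordered     = ordered
  }
  where
  open IsLabelling L

  ∘-[,] : ∀ u → [ S ∘ x , S ∘ y ]′ u ≡ S ([ x , y ]′ u)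
  ∘-[,] (inj₁ _) = refl
  ∘-[,] (inj₂ _) = refl

  surj : StrictlySurjective _≡_ [ S ∘ x , S ∘ y ]′
  surj v =
    let p , Sp≡v = S-surj v
        u , eq   = proj₂ bijective p
    in u , trans (∘-[,] u) (trans (cong S (eq refl)) Sp≡v)

HasLabelling⇒≡ : ∀ {n k} (G : Graph n) → HasLabelling G k → k + k ≡ n
HasLabelling⇒≡ G (x , y , L) =
  ↔⇒≡ (⤖⇒↔ (mk⤖ (IsLabelling.bijective L)) ↔-∘ +↔⊎)

k+k≡2*k : ∀ k → k + k ≡ 2 * k
k+k≡2*k k = cong (k +_) (sym (ℕ.+-identityʳ k))

legal⇒hasLabelling : ∀ {n} (G : Graph n) → Graph.NoIsolatedVertices G →
  (S : Fin n → Fin n) → IsLegalSequence G S → ∃[ k ] HasLabelling G k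
legal⇒hasLabelling {n} G noIsolated S isLegal =
  -- Pulling back along `S` renames vertices by position, so precedence in the sequence becomes the
  -- order of `Fin`.
  let k , L = FirstNeighbourMatching.hasLabelling (pullback S G) σ σ-adj σ-first
  in k , pullback-hasLabelling G distinct S-surj L
  where
  open Graph G using (Adj)
  open IsLegalSequence isLegal

  footprint : ∀ i → ∃[ v ] (Adj (S i) v × (∀ j → j < i → ¬ Adj (S j) v))
  -- Legality says nothing about the first vertex; any neighbour of it is newly footprinted.
  footprint zero    = let v , s~v = noIsolated (S zero) in v , s~v , λ _ ()
  footprint (suc i) = let v , s~v , new = legal (suc i) (s≤s z≤n) in
    v , s~v , λ j j<i s~v → new ((j , j<i) , s~v)

  S-surj : StrictlySurjective _≡_ S
  S-surj = injective⇒strictlySurjective distinct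

  σ : Fin n → Fin n
  σ i = proj₁ (S-surj (proj₁ (footprint i)))

  Sσ : ∀ i → S (σ i) ≡ proj₁ (footprint i)
  Sσ i = proj₂ (S-surj (proj₁ (footprint i)))

  σ-adj : ∀ i → Adj (S i) (S (σ i))
  σ-adj i = subst (Adj (S i)) (sym (Sσ i)) (proj₁ (proj₂ (footprint i)))

  σ-first : ∀ {i j} → Adj (S j) (S (σ i)) → i ≤ j
  σ-first {i} {j} s~σ = ℕ.≮⇒≥ λ j<i →
    proj₂ (proj₂ (footprint i)) j j<i (subst (Adj (S j)) (Sσ i) s~σ)

-- From a labelling to a total dominating sequence of all vertices.

labelling⇒grundy : ∀ {n k} (G : Graph n) → Graph.NoIsolatedVertices G →
  HasLabelling G k → IsGrundyTotalDominationNumber G (k + k)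
labelling⇒grundy {n} {k} G noIsolated L@(x , y , isLabelling) = record
  { attained   = S , record
    { isLegalSequence      = record { distinct = S-injective ; legal = λ p _ → footprint p }
    ; isTotalDominatingSet = λ v →
        let u , v~u = noIsolated v in u , S-surjective u , v~u
    }
  ; upperBound = λ {m} T isTDS → subst (m ℕ.≤_) (sym (HasLabelling⇒≡ G L))
      (injective⇒≤ (IsLegalSequence.distinct
        (IsTotalDominatingSequence.isLegalSequence isTDS)))
  }
  where
  open Graph G renaming (sym to Adj-sym)
  open IsLabelling isLabelling

  xy : Fin k ⊎ Fin k → Fin n
  xy = [ x , y ]′

  partner : Fin k ⊎ Fin k → Fin n
  partner = [ y , x ]′

  xy~partner : ∀ u → Adj (xy u) (partner u)
  xy~partner (inj₁ i) = matched i
  xy~partner (inj₂ i) = Adj-sym (matched i)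

  -- Reversing only the second block makes the positions read x₁ ... xₖ yₖ ... y₁.
  label : Fin (k + k) → Fin k ⊎ Fin k
  label p = map₂ opposite (splitAt k p)

  position : Fin k ⊎ Fin k → Fin (k + k)
  position u = join k k (map₂ opposite u)

  map₂-opposite-involutive : ∀ (u : Fin k ⊎ Fin k) → map₂ opposite (map₂ opposite u) ≡ u
  map₂-opposite-involutive (inj₁ i) = refl
  map₂-opposite-involutive (inj₂ i) = cong inj₂ (opposite-involutive i)

  position-label : ∀ p → position (label p) ≡ p
  position-label p =
    trans (cong (join k k) (map₂-opposite-involutive (splitAt k p))) (join-splitAt k k p)

  label-position : ∀ u → label (position u) ≡ u
  label-position u =
    trans (cong (map₂ opposite) (splitAt-join k k (map₂ opposite u)))
          (map₂-opposite-involutive u)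

  -- An earlier `x j` adjacent to `y i` violates `ordered`; a `y` never comes before an `x`; `x j`
  -- and `x i` are independent; and an earlier `y j` has a larger index than `y i`, so `ordered`
  -- forbids its adjacency to `x i`.
  partner-unseen : ∀ u w → position w < position u → ¬ Adj (xy w) (partner u)
  partner-unseen (inj₁ i) (inj₁ j) lt xj~yi = ℕ.<⇒≱
    (subst₂ ℕ._<_ (toℕ-↑ˡ j k) (toℕ-↑ˡ i k) lt) (ordered j i (Adj-sym xj~yi))
  partner-unseen (inj₁ i) (inj₂ j) lt _ = ℕ.<⇒≱
    (subst₂ ℕ._<_ (toℕ-↑ʳ k (opposite j)) (toℕ-↑ˡ i k) lt)
    (ℕ.≤-trans (ℕ.<⇒≤ (toℕ<n i)) (ℕ.m≤m+n k _))
  partner-unseen (inj₂ i) (inj₁ j) _ xj~xi = independent (j , refl) (i , refl) xj~xi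
  partner-unseen (inj₂ i) (inj₂ j) lt yj~xi = ℕ.<⇒≱
    (ℕ.+-cancelˡ-< k _ _
      (subst₂ ℕ._<_ (toℕ-↑ʳ k (opposite j)) (toℕ-↑ʳ k (opposite i)) lt))
    (opposite-anti-≤ (ordered i j yj~xi))

  S : Fin (k + k) → Fin n
  S = xy ∘ label

  S-injective : Injective _≡_ _≡_ S
  S-injective {p} {q} eq = begin
    p                   ≡⟨ position-label p ⟨
    position (label p)  ≡⟨ cong position (proj₁ bijective {label p} {label q} eq) ⟩
    position (label q)  ≡⟨ position-label q ⟩
    q                   ∎
    where open ≡-Reasoning

  S-surjective : StrictlySurjective _≡_ S
  S-surjective v = let u , eq = proj₂ bijective v in position u , eq (label-position u)

  footprint : ∀ p → ∃⟨ N (S p) ∖ ⋃ (Σ[ q ∈ Fin (k + k) ] q < p) (λ (q , _) → N (S q)) ⟩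
  footprint p = partner (label p) , xy~partner (label p) , λ ((q , q<p) , s~partner) →
    partner-unseen (label p) (label q)
      (subst₂ _<_ (sym (position-label q)) (sym (position-label p)) q<p) s~partner

mainTheorem5 : ∀ {n : ℕ} (G : Graph n) → Graph.NoIsolatedVertices G →
    IsGrundyTotalDominationNumber G n ⇔ (∃[ k ] (n ≡ 2 * k × ∃[ x ] ∃[ y ] IsLabelling G {k} x y))
mainTheorem5 {n} G noIsolated = mk⇔ to from
  where
  to : IsGrundyTotalDominationNumber G n → ∃[ k ] (n ≡ 2 * k × HasLabelling G k)
  to grundy =
    let S , isTDS = IsGrundyTotalDominationNumber.attained grundy
        k , L     = legal⇒hasLabelling G noIsolated S
                      (IsTotalDominatingSequence.isLegalSequence isTDS)
    in k , trans (sym (HasLabelling⇒≡ G L)) (k+k≡2*k k) , L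

  from : ∃[ k ] (n ≡ 2 * k × HasLabelling G k) → IsGrundyTotalDominationNumber G n
  from (k , _ , L) = subst (IsGrundyTotalDominationNumber G) (HasLabelling⇒≡ G L)
    (labelling⇒grundy G noIsolated L)
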